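{- Neither the unimodal spi-logic $\mathsf{SPi}+\{\iota_{wcon}\}$ nor $\mathsf{SPi}_{lin}=\mathsf{SPi}+\{p\to\Diamond p,\ \Diamond\Diamond p\to\Diamond p,\ \iota_{wcon}\}$ is complex, where $\iota_{wcon}=\big(\Diamond(p\wedge q)\wedge\Diamond(p\wedge r)\to\Diamond(p\wedge\Diamond q\wedge\Diamond r)\big)$.
   Context: Unimodal setting: one diamond $\Diamond$. Sp-formulas: built from propositional variables and $\top$ by $\wedge$ and $\Diamond$; sp-implications $\sigma\to\tau$. A SLO is an algebra $(A,\wedge,\top,\Diamond)$ with $(A,\wedge,\top)$ a meet-semilattice with top and $\Diamond$ monotone; it validates $\sigma\to\tau$ if $\sigma[\mathfrak a]\le\tau[\mathfrak a]$ for all valuations. Frames $(W,R)$ with standard Kripke semantics. $\mathsf{SPi}+\Sigma$ denotes the set of sp-implications valid in all SLOs validating $\Sigma$. For a frame $\mathfrak F=(W,R)$, $\mathfrak F^\star=(2^W,\cap,W,\Diamond^+)$ with $\Diamond^+X=\{w\mid\exists v\in X,(w,v)\in R\}$. A spi-logic $L$ is complex if every SLO validating $L$ embeds (injectively, preserving $\wedge,\top,\Diamond$) into $\mathfrak F^\star$ for some frame $\mathfrak F$ validating $L$. -}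

module Defs where

open import Algebra.Lattice.Bundles using (BoundedMeetSemilattice)
open import Data.Nat.Base using (ℕ)
open import Data.Product.Base using (∃-syntax; Σ-syntax; _×_; _,_; proj₁; proj₂)
open import Data.Unit.Polymorphic.Base as Unit using (tt)
open import Function.Definitions using (Congruent; Injective)
open import Level using (Level; 0ℓ; suc; _⊔_)
open import Relation.Binary.Core using (Rel)
import Relation.Binary.Construct.NaturalOrder.Left as NaturalOrder
open import Relation.Unary using (Pred; _∈_; _≐_; _∩_; _∪_; ｛_｝)
open import Relation.Unary.Algebra using (∩-isSemigroup; ∩-comm; ∩-idem)

infixr 7 _∧_
infix 8 ◇_
infix 4 _⇒_

data SpFormula : Set where
  var : ℕ → SpFormula
  ⊤   : SpFormula
  _∧_ : SpFormula → SpFormula → SpFormula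
  ◇_  : SpFormula → SpFormula

record SpImplication : Set where
  constructor _⇒_
  field
    antecedent : SpFormula
    consequent : SpFormula

record SLO (c ℓ : Level) : Set (suc (c ⊔ ℓ)) where
  field
    boundedMeetSemilattice : BoundedMeetSemilattice c ℓ

  open BoundedMeetSemilattice boundedMeetSemilattice public
    renaming (_∧_ to _⊓_; ⊤ to 𝟏)

  -- The order of the semilattice: a ≤ b is a ≈ a ⊓ b.
  open NaturalOrder _≈_ _⊓_ public using (_≤_)

  field
    ◇′      : Carrier → Carrier
    ◇′-mono : ∀ {a b} → a ≤ b → ◇′ a ≤ ◇′ b

module _ {c ℓ} (A : SLO c ℓ) where
  open SLO A

  eval : (ℕ → Carrier) → SpFormula → Carrier
  eval 𝔞 (var n) = 𝔞 n
  eval 𝔞 ⊤       = 𝟏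
  eval 𝔞 (σ ∧ τ) = eval 𝔞 σ ⊓ eval 𝔞 τ
  eval 𝔞 (◇ σ)   = ◇′ (eval 𝔞 σ)

  SLOValid : SpImplication → Set (c ⊔ ℓ)
  SLOValid (σ ⇒ τ) = ∀ (𝔞 : ℕ → Carrier) → eval 𝔞 σ ≤ eval 𝔞 τ

  SLOValidates : ∀ {s} → Pred SpImplication s → Set (c ⊔ ℓ ⊔ s)
  SLOValidates Γ = ∀ ι → ι ∈ Γ → SLOValid ι

-- The SLOs range over the universe given by c and ℓ.
SPi+ : ∀ (c ℓ : Level) → Pred SpImplication 0ℓ → Pred SpImplication (suc (c ⊔ ℓ))
SPi+ c ℓ Γ ι = ∀ (A : SLO c ℓ) → SLOValidates A Γ → SLOValid A ι

record Frame (w : Level) : Set (suc w) where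
  field
    W : Set w
    R : Rel W w

module _ {w} (𝔉 : Frame w) where
  open Frame 𝔉

  Forces : (ℕ → Pred W w) → W → SpFormula → Set w
  Forces V x (var n) = x ∈ V n
  Forces V x ⊤       = Unit.⊤
  Forces V x (σ ∧ τ) = Forces V x σ × Forces V x τ
  Forces V x (◇ σ)   = ∃[ y ] R x y × Forces V y σ

  FrameValid : SpImplication → Set (suc w)
  FrameValid (σ ⇒ τ) = ∀ (V : ℕ → Pred W w) (x : W) → Forces V x σ → Forces V x τ

  FrameValidates : ∀ {s} → Pred SpImplication s → Set (suc w ⊔ s)
  FrameValidates Γ = ∀ ι → ι ∈ Γ → FrameValid ι

  ◇⁺ : Pred W w → Pred W w
  ◇⁺ X x = ∃[ v ] v ∈ X × R x v

  -- 𝔉⋆ = (2^W, ∩, W, ◇⁺). Subsets of W are predicates up to extensional equality _≐_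
  -- (Boolean-valued ones would not be closed under ◇⁺ constructively).
  _⋆ : SLO (suc w) w
  _⋆ = record
    { boundedMeetSemilattice = record
      { Carrier = Pred W w
      ; _≈_     = _≐_
      ; _∧_     = _∩_
      ; ⊤       = λ _ → Unit.⊤
      ; isBoundedMeetSemilattice = record
        { isCommutativeMonoid = record
          { isMonoid = record
            { isSemigroup = ∩-isSemigroup W w
            ; identity    = (λ _ → proj₂ , (tt ,_)) , (λ _ → proj₁ , (_, tt))
            }
          ; comm = ∩-comm
          }
        ; idem = ∩-idem
        }
      }
    ; ◇′      = ◇⁺
    ; ◇′-mono = λ { (X⊆X∩Y , _) →
        (λ { (v , v∈X , r) → (v , v∈X , r) , (v , proj₂ (X⊆X∩Y v∈X) , r) }) , proj₁ }
    }

record Embedding {c₁ ℓ₁ c₂ ℓ₂} (A : SLO c₁ ℓ₁) (B : SLO c₂ ℓ₂) : Set (c₁ ⊔ ℓ₁ ⊔ c₂ ⊔ ℓ₂) where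
  private
    module A = SLO A
    module B = SLO B
  field
    f         : A.Carrier → B.Carrier
    cong      : Congruent A._≈_ B._≈_ f
    injective : Injective A._≈_ B._≈_ f
    ⊓-homo    : ∀ a b → f (a A.⊓ b) B.≈ f a B.⊓ f b
    𝟏-homo    : f A.𝟏 B.≈ B.𝟏
    ◇-homo    : ∀ a → f (A.◇′ a) B.≈ B.◇′ (f a)

-- SLOs range over the universe given by c and ℓ, frames over the universe given by w.
Complex : ∀ (c ℓ w : Level) {s : Level} → Pred SpImplication s → Set (suc (c ⊔ ℓ ⊔ w) ⊔ s)
Complex c ℓ w L =
  ∀ (A : SLO c ℓ) → SLOValidates A L →
  Σ[ 𝔉 ∈ Frame w ] FrameValidates 𝔉 L × Embedding A (𝔉 ⋆)

private
  p q r : SpFormula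
  p = var 0
  q = var 1
  r = var 2

ι-refl ι-trans ι-wcon : SpImplication
ι-refl  = p ⇒ ◇ p
ι-trans = ◇ ◇ p ⇒ ◇ p
ι-wcon  = ◇ (p ∧ q) ∧ ◇ (p ∧ r) ⇒ ◇ (p ∧ ◇ q ∧ ◇ r)

SPi-lin : ∀ (c ℓ : Level) → Pred SpImplication (suc (c ⊔ ℓ))
SPi-lin c ℓ = SPi+ c ℓ (｛ ι-refl ｝ ∪ ｛ ι-trans ｝ ∪ ｛ ι-wcon ｝)

{-# OPTIONS --safe #-}
module Submission where

-- On a frame validating ι-wcon, any two successors y, z of a point x satisfy y R z or z R y.
-- Hence in 𝔉⋆, and in all its subalgebras, a ⊓ ◇ b ≤ c and b ⊓ ◇ a ≤ c imply ◇ a ⊓ ◇ b ≤ ◇ c.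
-- This quasi-identity fails in the following SLO validating ι-refl, ι-trans and ι-wcon:
--
--              𝟙
--            /   \
--          ◇a     ◇b          ◇ maps a to ◇a and b to ◇b,
--         /   \  /   \        and fixes all other elements.
--        a     e      b
--          \   |   /
--              𝟘
--
-- since a ⊓ ◇b = b ⊓ ◇a = 𝟘 = ◇ 𝟘, whereas ◇a ⊓ ◇b = e.

open import Defs
open import Data.Fin.Base using (Fin)
open import Data.Fin.Patterns using (0F; 1F; 2F; 3F; 4F; 5F; 6F)
open import Data.Fin.Properties using (_≟_; all?)
open import Data.Nat.Base using (ℕ; zero; suc)
open import Data.Product.Base using (_×_; _,_; proj₁; proj₂)
open import Data.Sum.Base using (_⊎_; inj₁; inj₂)
open import Level using (Level; Lift; lift; lower; 0ℓ)
open import Relation.Binary.PropositionalEquality using (_≡_; refl; sym; trans; cong₂)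
open import Relation.Nullary.Decidable using (from-yes; _→-dec_)
open import Relation.Nullary.Negation.Core using (¬_; contradiction)
open import Relation.Unary using (Pred; _∈_; _⊆_; ｛_｝; _∪_)

module _ {w} {𝔉 : Frame w} (wcon : FrameValid 𝔉 ι-wcon) where
  open Frame 𝔉

  -- Make `p` true exactly at `y` and `z`, `q` only at `y`, and `r` only at `z`. The point supplied
  -- by the consequent is then `y` or `z`, and it sees both of them, in particular the other one.
  wcon⇒connected-successors : ∀ {x y z} → R x y → R x z → R y z ⊎ R z y
  wcon⇒connected-successors {x} {y} {z} xRy xRz = conclude (wcon V x
    ((y , xRy , inj₁ refl , refl) , (z , xRz , inj₂ refl , refl)))
    where
    V : ℕ → Pred W w
    V zero          = ｛ y ｝ ∪ ｛ z ｝
    V (suc zero)    = ｛ y ｝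
    V (suc (suc _)) = ｛ z ｝

    conclude : Forces 𝔉 V x (◇ (var 0 ∧ ◇ var 1 ∧ ◇ var 2)) → R y z ⊎ R z y
    conclude (_ , _ , inj₁ refl , _ , (_ , yRz , refl)) = inj₁ yRz
    conclude (_ , _ , inj₂ refl , (_ , zRy , refl) , _) = inj₂ zRy

  -- Given witnesses `y` in `X` and `z` in `Y`, whichever sees the other lies in `Z`.
  wcon⇒◇-quasi-identity : ∀ {X Y Z : Pred W w} →
    (∀ {y} → y ∈ X → y ∈ ◇⁺ 𝔉 Y → y ∈ Z) →
    (∀ {y} → y ∈ Y → y ∈ ◇⁺ 𝔉 X → y ∈ Z) →
    ∀ {x} → x ∈ ◇⁺ 𝔉 X → x ∈ ◇⁺ 𝔉 Y → x ∈ ◇⁺ 𝔉 Z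
  wcon⇒◇-quasi-identity X∩◇Y⊆Z Y∩◇X⊆Z (y , y∈X , xRy) (z , z∈Y , xRz)
    with wcon⇒connected-successors xRy xRz
  ... | inj₁ yRz = y , X∩◇Y⊆Z y∈X (z , z∈Y , yRz) , xRy
  ... | inj₂ zRy = z , Y∩◇X⊆Z z∈Y (y , y∈X , zRy) , xRz

Element : Set
Element = Fin 7

pattern 𝟘  = 0F
pattern a  = 1F
pattern b  = 2F
pattern e  = 3F
pattern ◇a = 4F
pattern ◇b = 5F
pattern 𝟙  = 6F

infixr 7 _⊓_

-- The catch-all clauses follow the diagram: for `a` and `b` they catch the elements not above, for
-- `e` those above, for `◇a` and `◇b` those below.
_⊓_ : Element → Element → Element
𝟘  ⊓ y  = 𝟘
a  ⊓ a  = a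
a  ⊓ ◇a = a
a  ⊓ 𝟙  = a
a  ⊓ _  = 𝟘
b  ⊓ b  = b
b  ⊓ ◇b = b
b  ⊓ 𝟙  = b
b  ⊓ _  = 𝟘
e  ⊓ 𝟘  = 𝟘
e  ⊓ a  = 𝟘
e  ⊓ b  = 𝟘
e  ⊓ _  = e
◇a ⊓ b  = 𝟘
◇a ⊓ ◇b = e
◇a ⊓ 𝟙  = ◇a
◇a ⊓ y  = y
◇b ⊓ a  = 𝟘
◇b ⊓ ◇a = e
◇b ⊓ 𝟙  = ◇b
◇b ⊓ y  = y
𝟙  ⊓ y  = y

dia : Element → Element
dia a = ◇a
dia b = ◇b
dia x = x

infix 4 _≤_

_≤_ : Element → Element → Set
x ≤ y = x ≡ x ⊓ y

⊓-assoc : ∀ x y z → (x ⊓ y) ⊓ z ≡ x ⊓ (y ⊓ z)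
⊓-assoc = from-yes (all? λ x → all? λ y → all? λ z → (x ⊓ y) ⊓ z ≟ x ⊓ (y ⊓ z))

⊓-comm : ∀ x y → x ⊓ y ≡ y ⊓ x
⊓-comm = from-yes (all? λ x → all? λ y → x ⊓ y ≟ y ⊓ x)

⊓-idem : ∀ x → x ⊓ x ≡ x
⊓-idem = from-yes (all? λ x → x ⊓ x ≟ x)

⊓-identityʳ : ∀ x → x ⊓ 𝟙 ≡ x
⊓-identityʳ = from-yes (all? λ x → x ⊓ 𝟙 ≟ x)

dia-mono : ∀ x y → x ≤ y → dia x ≤ dia y
dia-mono = from-yes (all? λ x → all? λ y → (x ≟ x ⊓ y) →-dec (dia x ≟ dia x ⊓ dia y))

dia-refl : ∀ x → x ≤ dia x
dia-refl = from-yes (all? λ x → x ≟ x ⊓ dia x)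

dia-trans : ∀ x → dia (dia x) ≤ dia x
dia-trans = from-yes (all? λ x → dia (dia x) ≟ dia (dia x) ⊓ dia x)

-- If `dia x` is `x`, monotonicity puts the left side below `x ⊓ dia y ⊓ dia z`, and `dia` is
-- inflationary. Otherwise `x` is the atom `a` or `b`: either a meet is `𝟘` and so is the left side,
-- or `y` and `z` are above `x`. The proof term checks all triples.
dia-wcon : ∀ x y z → dia (x ⊓ y) ⊓ dia (x ⊓ z) ≤ dia (x ⊓ dia y ⊓ dia z)
dia-wcon = from-yes (all? λ x → all? λ y → all? λ z →
  dia (x ⊓ y) ⊓ dia (x ⊓ z) ≟ (dia (x ⊓ y) ⊓ dia (x ⊓ z)) ⊓ dia (x ⊓ dia y ⊓ dia z))

module _ (c ℓ : Level) where

  counterexample : SLO c ℓ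
  counterexample = record
    { boundedMeetSemilattice = record
      { Carrier = Lift c Element
      ; _≈_     = λ x y → Lift ℓ (lower x ≡ lower y)
      ; _∧_     = λ x y → lift (lower x ⊓ lower y)
      ; ⊤       = lift 𝟙
      ; isBoundedMeetSemilattice = record
        { isCommutativeMonoid = record
          { isMonoid = record
            { isSemigroup = record
              { isMagma = record
                { isEquivalence = record
                  { refl  = lift refl
                  ; sym   = λ p → lift (sym (lower p))
                  ; trans = λ p q → lift (trans (lower p) (lower q))
                  }
                ; ∙-cong = λ p q → lift (cong₂ _⊓_ (lower p) (lower q))
                }
              ; assoc = λ x y z → lift (⊓-assoc (lower x) (lower y) (lower z))
              }
            ; identity = (λ _ → lift refl) , (λ x → lift (⊓-identityʳ (lower x)))
            }
          ; comm = λ x y → lift (⊓-comm (lower x) (lower y))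
          }
        ; idem = λ x → lift (⊓-idem (lower x))
        }
      }
    ; ◇′      = λ x → lift (dia (lower x))
    ; ◇′-mono = λ {x} {y} p → lift (dia-mono (lower x) (lower y) (lower p))
    }

  counterexample-wcon : SLOValid counterexample ι-wcon
  counterexample-wcon 𝔞 = lift (dia-wcon (lower (𝔞 0)) (lower (𝔞 1)) (lower (𝔞 2)))

  counterexample-lin :
    SLOValidates counterexample (｛ ι-refl ｝ ∪ ｛ ι-trans ｝ ∪ ｛ ι-wcon ｝)
  counterexample-lin _ (inj₁ refl)        𝔞 = lift (dia-refl (lower (𝔞 0)))
  counterexample-lin _ (inj₂ (inj₁ refl)) 𝔞 = lift (dia-trans (lower (𝔞 0)))
  counterexample-lin _ (inj₂ (inj₂ refl)) = counterexample-wcon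

  counterexample-not-embeddable : ∀ {w} {𝔉 : Frame w} →
    FrameValid 𝔉 ι-wcon → ¬ Embedding counterexample (𝔉 ⋆)
  counterexample-not-embeddable {w} {𝔉} wcon embedding =
    contradiction (lower (injective {lift 𝟘} {lift e} (fᵉ𝟘⊆fᵉe , fᵉe⊆fᵉ𝟘))) λ ()
    where
    open Embedding embedding using (f; injective; ⊓-homo; ◇-homo)

    fᵉ : Element → Pred (Frame.W 𝔉) w
    fᵉ x = f (lift x)

    ⊓⁺ : ∀ x y {u} → u ∈ fᵉ x → u ∈ fᵉ y → u ∈ fᵉ (x ⊓ y)
    ⊓⁺ x y u∈x u∈y = proj₂ (⊓-homo (lift x) (lift y)) (u∈x , u∈y)

    ⊓⁻ : ∀ x y {u} → u ∈ fᵉ (x ⊓ y) → u ∈ fᵉ x × u ∈ fᵉ y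
    ⊓⁻ x y = proj₁ (⊓-homo (lift x) (lift y))

    ◇⁺⊆ : ∀ x → ◇⁺ 𝔉 (fᵉ x) ⊆ fᵉ (dia x)
    ◇⁺⊆ x = proj₂ (◇-homo (lift x))

    ⊆◇⁺ : ∀ x → fᵉ (dia x) ⊆ ◇⁺ 𝔉 (fᵉ x)
    ⊆◇⁺ x = proj₁ (◇-homo (lift x))

    fᵉ𝟘⊆fᵉe : fᵉ 𝟘 ⊆ fᵉ e
    fᵉ𝟘⊆fᵉe u∈𝟘 = proj₂ (⊓⁻ 𝟘 e u∈𝟘)

    fᵉe⊆fᵉ𝟘 : fᵉ e ⊆ fᵉ 𝟘
    fᵉe⊆fᵉ𝟘 u∈e with u∈◇a , u∈◇b ← ⊓⁻ ◇a ◇b u∈e =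
      -- The sets are `fᵉ a`, `fᵉ b` and `fᵉ 𝟘`; the last may be nonempty, since an embedding need
      -- not preserve the bottom. Both `a ⊓ ◇b` and `b ⊓ ◇a` compute to `𝟘`, as does `dia 𝟘`.
      ◇⁺⊆ 𝟘 (wcon⇒◇-quasi-identity wcon
        (λ y∈a y∈◇b → ⊓⁺ a ◇b y∈a (◇⁺⊆ b y∈◇b))
        (λ y∈b y∈◇a → ⊓⁺ b ◇a y∈b (◇⁺⊆ a y∈◇a))
        (⊆◇⁺ a u∈◇a) (⊆◇⁺ b u∈◇b))

  not-complex : ∀ w {Γ : Pred SpImplication 0ℓ} →
    ι-wcon ∈ Γ → SLOValidates counterexample Γ → ¬ Complex c ℓ w (SPi+ c ℓ Γ)
  not-complex w ι∈Γ validΓ complex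
    -- A member of the logic holds in every SLO validating `Γ`, so in particular in
    -- `counterexample`.
    with 𝔉 , 𝔉-valid , embedding ← complex counterexample (λ _ ι∈L → ι∈L counterexample validΓ) =
    counterexample-not-embeddable (𝔉-valid ι-wcon (λ _ valid → valid ι-wcon ι∈Γ)) embedding

theorem7p11 : ∀ (c ℓ w : Level) →
    (¬ Complex c ℓ w (SPi+ c ℓ ｛ ι-wcon ｝)) × (¬ Complex c ℓ w (SPi-lin c ℓ))
theorem7p11 c ℓ w =
  not-complex c ℓ w refl (λ { _ refl → counterexample-wcon c ℓ }) ,
  not-complex c ℓ w (inj₂ (inj₂ refl)) (counterexample-lin c ℓ)
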